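{- Consider the protocol model without a $\mathsf{TTP}$. For all refinements $\mathsf O'\preceq\mathsf O$ and $\mathsf R'\preceq\mathsf R$, the following assertions hold: 1. (Classical co-synthesis fails) $[\![\mathsf O'\parallel\mathsf R\parallel\mathrm{Sc}]\!]\not\subseteq\varphi_{\mathsf O}$. 2. (Assume-guarantee synthesis fails) Either (a) $[\![\mathsf O'\parallel\mathsf R\parallel\mathrm{Sc}]\!]\not\subseteq(\varphi_{\mathsf R}\Rightarrow\varphi_{\mathsf O})$, or (b) $[\![\mathsf O'\parallel\mathsf R\parallel\mathrm{Sc}]\!]\subseteq(\varphi_{\mathsf R}\Rightarrow\varphi_{\mathsf O})$, $[\![\mathsf R'\parallel\mathsf O\parallel\mathrm{Sc}]\!]\subseteq(\varphi_{\mathsf O}\Rightarrow\varphi_{\mathsf R})$, and $[\![\mathsf O'\parallel\mathsf R'\parallel\mathrm{Sc}]\!]\not\subseteq(\varphi_{\mathsf O}\wedge\varphi_{\mathsf R})$.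
   Context: **Protocol model without a $\mathsf{TTP}$.** There are two (most general) processes: the originator $\mathsf O$ and the recipient $\mathsf R$; there is no trusted third party. $\mathsf O$ may send messages $m_1,m_3$ to $\mathsf R$; $\mathsf R$ may send $m_2,m_4$ to $\mathsf O$. Each process, when scheduled, chooses a move: the idle move $\iota$ or sending a message it can compose. Composability: $\mathsf O$ can send $m_1$ from the start; $\mathsf R$ can send $m_2$ only after receiving $m_1$; $\mathsf O$ can send $m_3$ only after receiving $m_2$; $\mathsf R$ can send $m_4$ only after receiving $m_3$. The most general processes may choose any composable move at any state. (Requests addressed to a $\mathsf{TTP}$ are never answered.) **Predicates** (Boolean variables, initially false, monotonic: once true they stay true). Set by $\mathsf O$: $M_1,M_3$ on sending $m_1,m_3$; $\mathrm{EOR}$ on receiving $m_2$; $\mathrm{Sig}_{\mathsf R}^{\mathsf R}$ on receiving $m_4$. Set by $\mathsf R$: $M_2,M_4$ on sending $m_2,m_4$; $\mathrm{EOO}$ on receiving $m_1$; $\mathrm{Sig}_{\mathsf O}^{\mathsf O}$ on receiving $m_3$. The predicates $\mathrm{AB}_{\mathsf O},\mathrm{AB}_{\mathsf R}$ (abort tokens received from a $\mathsf{TTP}$) and $\mathrm{Sig}_{\mathsf O}^{\mathsf{TTP}},\mathrm{Sig}_{\mathsf R}^{\mathsf{TTP}}$ (replacement signatures received from a $\mathsf{TTP}$) are always false, since there is no $\mathsf{TTP}$. Each process sees only the variables it sets. **Refinement.** $P'\preceq P$ means that $P'$ has the same variables as $P$, and at every valuation of those variables a nonempty subset of the moves of $P$,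 with the same effect. **Traces.** Channels between $\mathsf O$ and $\mathsf R$ are unreliable (messages may never be delivered, or may be delivered). A scheduler assigns turns to the processes as a function of the history; it is fair if every process gets infinitely many turns. $[\![P_1\parallel P_2\parallel\mathrm{Sc}]\!]$ is the set of infinite sequences of valuations, starting from the all-false valuation, generated by the two processes under all fair schedulers and all channel behaviours. A formula is identified with the set of traces satisfying it. **Objectives** (LTL; $\Box$ = always, $\Diamond$ = eventually): - $\varphi_{\mathsf O}=\Diamond M_1\wedge\Box\big[(\Diamond\mathrm{Sig}_{\mathsf R}^{\mathsf R}\vee(\Diamond\mathrm{Sig}_{\mathsf R}^{\mathsf{TTP}}\wedge\Box\neg\mathrm{AB}_{\mathsf O}))\vee(\Diamond\mathrm{AB}_{\mathsf O}\wedge\Box(\neg\mathrm{Sig}_{\mathsf O}^{\mathsf O}\wedge\neg\mathrm{Sig}_{\mathsf O}^{\mathsf{TTP}}))\big]$, - $\varphi_{\mathsf R}=\Box\big[\mathrm{EOO}\Rightarrow\big((\Diamond\mathrm{Sig}_{\mathsf O}^{\mathsf O}\vee(\Diamond\mathrm{Sig}_{\mathsf O}^{\mathsf{TTP}}\wedge\Box\neg\mathrm{AB}_{\mathsf R}))\vee(\Diamond\mathrm{AB}_{\mathsf R}\wedge\Box(\neg\mathrm{Sig}_{\mathsf R}^{\mathsf R}\wedge\neg\mathrm{Sig}_{\mathsf R}^{\mathsf{TTP}}))\big)\big]$, which, in the absence of a $\mathsf{TTP}$, simplify to $\varphi_{\mathsf O}=\Diamond M_1\wedge\Diamond\mathrm{Sig}_{\mathsf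 R}^{\mathsf R}$ and $\varphi_{\mathsf R}=\Box(\mathrm{EOO}\Rightarrow\Diamond\mathrm{Sig}_{\mathsf O}^{\mathsf O})$. -}

module Defs where

open import Data.Bool using (Bool; true; false)
open import Data.List using (List; foldr; applyUpTo)
open import Data.List.Relation.Unary.All using (All)
open import Data.Nat using (ℕ; suc; _+_; _≤_)
open import Data.Product using (∃-syntax; _×_; _,_; proj₁; proj₂)
open import Level using (0ℓ)
open import Relation.Binary.PropositionalEquality using (_≡_)
open import Relation.Unary using (Pred; _∈_; _⊆_; Satisfiable; ∁; _∩_; _∪_; _⇒_)

data Agent : Set where
  originator recipient : Agent

data Message : Set where
  m₁ m₂ m₃ m₄ : Message

data Move : Set where
  ι    : Move
  send : Message → Move

-- SigX^Y is the signature of X as issued by Y.  Without a TTP nothing ever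
-- sets AB-O, AB-R, SigR^TTP and SigO^TTP; they are kept because the
-- objectives mention them.
record OVal : Set where
  constructor oval
  field
    M₁ M₃ EOR SigR^R AB-O SigR^TTP : Bool
open OVal public

record RVal : Set where
  constructor rval
  field
    M₂ M₄ EOO SigO^O AB-R SigO^TTP : Bool
open RVal public

Valuation : Set
Valuation = OVal × RVal

initial : Valuation
initial = oval false false false false false false
        , rval false false false false false false

-- A process over the local valuations Val: the moves it may choose depend
-- only on its own variables.
record Process (Val : Set) : Set₁ where
  field
    moves    : Val → Pred Move 0ℓ
    nonempty : ∀ v → Satisfiable (moves v)
    effect   : Val → Move → Val
open Process public

infix 4 _≼_
record _≼_ {Val : Set} (P′ P : Process Val) : Set where
  field
    moves-⊆     : ∀ v → moves P′ v ⊆ moves P v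
    effect-same : ∀ v {m} → m ∈ moves P′ v → effect P′ v m ≡ effect P v m
open _≼_ public

data OMoves (v : OVal) : Pred Move 0ℓ where
  idle    :                OMoves v ι
  send-m₁ :                OMoves v (send m₁)
  send-m₃ : EOR v ≡ true → OMoves v (send m₃)

data RMoves (v : RVal) : Pred Move 0ℓ where
  idle    :                   RMoves v ι
  send-m₂ : EOO v ≡ true →    RMoves v (send m₂)
  send-m₄ : SigO^O v ≡ true → RMoves v (send m₄)

O-effect : OVal → Move → OVal
O-effect v (send m₁) = record v { M₁ = true }
O-effect v (send m₃) = record v { M₃ = true }
O-effect v _         = v

R-effect : RVal → Move → RVal
R-effect v (send m₂) = record v { M₂ = true }
R-effect v (send m₄) = record v { M₄ = true }
R-effect v _         = v

O : Process OVal
O = record { moves = OMoves ; nonempty = λ _ → ι , idle ; effect = O-effect }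

R : Process RVal
R = record { moves = RMoves ; nonempty = λ _ → ι , idle ; effect = R-effect }

-- Whether a message has been sent so far.  Receipt is idempotent, so the
-- channel needs no state of its own: a lost message is one that is never
-- delivered, and delivering a message again changes nothing.
Sent : Valuation → Message → Set
Sent v m₁ = M₁ (proj₁ v) ≡ true
Sent v m₂ = M₂ (proj₂ v) ≡ true
Sent v m₃ = M₃ (proj₁ v) ≡ true
Sent v m₄ = M₄ (proj₂ v) ≡ true

receive : Message → Valuation → Valuation
receive m₁ (o , r) = o , record r { EOO = true }
receive m₂ (o , r) = record o { EOR = true } , r
receive m₃ (o , r) = o , record r { SigO^O = true }
receive m₄ (o , r) = record o { SigR^R = true } , r

data Turn (P : Process OVal) (Q : Process RVal) : Agent → Valuation → Valuation → Set where
  O-turn : ∀ {o r m} → m ∈ moves P o → Turn P Q originator (o , r) (effect P o m , r)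
  R-turn : ∀ {o r m} → m ∈ moves Q r → Turn P Q recipient (o , r) (o , effect Q r m)

-- One step: the scheduled process makes its move, then the channel delivers
-- an arbitrary (possibly empty) collection of messages that have been sent.
Step : Process OVal → Process RVal → Agent → Valuation → Valuation → Set
Step P Q a v w =
  ∃[ u ] ∃[ ms ] Turn P Q a v u × All (Sent u) ms × w ≡ foldr receive u ms

Trace : Set
Trace = ℕ → Valuation

-- Applied to the history [ t 0 , … , t n ] it names the process that takes
-- the step from t n to t (suc n).
Scheduler : Set
Scheduler = List Valuation → Agent

scheduled : Scheduler → Trace → ℕ → Agent
scheduled sc t n = sc (applyUpTo t (suc n))

record Generates (P : Process OVal) (Q : Process RVal) (sc : Scheduler) (t : Trace) : Set where
  field
    start : t 0 ≡ initial
    step  : ∀ n → Step P Q (scheduled sc t n) (t n) (t (suc n))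
open Generates public

Fair : Process OVal → Process RVal → Scheduler → Set
Fair P Q sc =
  ∀ t → Generates P Q sc t → ∀ a n → ∃[ k ] n ≤ k × scheduled sc t k ≡ a

⟦_∥_∥Sc⟧ : Process OVal → Process RVal → Pred Trace 0ℓ
⟦ P ∥ Q ∥Sc⟧ t = ∃[ sc ] Fair P Q sc × Generates P Q sc t

-- LTL formulas are sets of traces; the connectives are those on predicates.
Formula : Set₁
Formula = Pred Trace 0ℓ

suffix : ℕ → Trace → Trace
suffix n t k = t (n + k)

infix 9 □_ ◇_

□_ ◇_ : Formula → Formula
(□ φ) t = ∀ n → φ (suffix n t)
(◇ φ) t = ∃[ n ] φ (suffix n t)

⟨_⟩ᴼ : (OVal → Bool) → Formula
⟨ x ⟩ᴼ t = x (proj₁ (t 0)) ≡ true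

⟨_⟩ᴿ : (RVal → Bool) → Formula
⟨ x ⟩ᴿ t = x (proj₂ (t 0)) ≡ true

φ-O : Formula
φ-O = ◇ ⟨ M₁ ⟩ᴼ ∩
      □ ((◇ ⟨ SigR^R ⟩ᴼ ∪ (◇ ⟨ SigR^TTP ⟩ᴼ ∩ □ ∁ ⟨ AB-O ⟩ᴼ)) ∪
         (◇ ⟨ AB-O ⟩ᴼ ∩ □ (∁ ⟨ SigO^O ⟩ᴿ ∩ ∁ ⟨ SigO^TTP ⟩ᴿ)))

φ-R : Formula
φ-R = □ (⟨ EOO ⟩ᴿ ⇒
         ((◇ ⟨ SigO^O ⟩ᴿ ∪ (◇ ⟨ SigO^TTP ⟩ᴿ ∩ □ ∁ ⟨ AB-R ⟩ᴿ)) ∪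
          (◇ ⟨ AB-R ⟩ᴿ ∩ □ (∁ ⟨ SigR^R ⟩ᴼ ∩ ∁ ⟨ SigR^TTP ⟩ᴼ))))

{-# OPTIONS --safe #-}

-- The recipient of the most general protocol may idle forever, and the channel
-- may lose every message.  Against any refinement of the originator this gives
-- a fair trace on which EOO and SigR^R stay false: φ-R holds vacuously and φ-O
-- fails.  This trace refutes both classical co-synthesis and the first half of
-- assume-guarantee synthesis, so alternative (a) always applies.

module Submission where

open import Data.Bool using (false; true)
open import Data.List using (length)
open import Data.List.Properties using (length-applyUpTo)
open import Data.List.Relation.Unary.All using ([])
open import Data.Nat using (ℕ; zero; suc; _+_; _≤_; z≤n; s≤s)
open import Data.Product using (∃-syntax; _×_; _,_; proj₁; proj₂)
open import Data.Sum using (_⊎_; inj₁; inj₂)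
open import Function using (_∘_)
open import Relation.Binary.PropositionalEquality using (_≡_; _≢_; refl; sym; trans; cong; subst)
open import Relation.Nullary using (contradiction)
open import Relation.Unary using (_⊆_; _⊈_; _∩_; _⇒_; _∈_; _∉_)
open import Defs

-- At step `n` the history has length `suc n`, so the clause for `suc zero` decides the first step
-- and the originator moves first.
alternate : ℕ → Agent
alternate zero          = recipient
alternate (suc zero)    = originator
alternate (suc (suc n)) = alternate n

alternate-recurs : ∀ a n → ∃[ k ] n ≤ k × alternate (suc k) ≡ a
alternate-recurs originator zero          = 0 , z≤n , refl
alternate-recurs recipient  zero          = 1 , z≤n , refl
alternate-recurs originator (suc zero)    = 2 , s≤s z≤n , refl
alternate-recurs recipient  (suc zero)    = 1 , s≤s z≤n , refl
alternate-recurs a          (suc (suc n)) with alternate-recurs a n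
... | k , n≤k , eq = suc (suc k) , s≤s (s≤s n≤k) , eq

roundRobin : Scheduler
roundRobin = alternate ∘ length

scheduled-roundRobin : ∀ t n → scheduled roundRobin t n ≡ alternate (suc n)
scheduled-roundRobin t n = cong alternate (length-applyUpTo t (suc n))

-- The choice depends only on the length of the history, so each process recurs along every sequence
-- of valuations.
roundRobin-fair : ∀ P Q → Fair P Q roundRobin
roundRobin-fair P Q t _ a n with alternate-recurs a n
... | k , n≤k , eq = k , n≤k , trans (scheduled-roundRobin t k) eq

-- Each disjunct under the box of `φ-O` requires one of these three variables to become true
-- eventually.
NoReply : OVal → Set
NoReply o = SigR^R o ≡ false × SigR^TTP o ≡ false × AB-O o ≡ false

-- A move of the originator writes at most `M₁` or `M₃`.
O-effect-NoReply : ∀ {o} m → NoReply o → NoReply (O-effect o m)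
O-effect-NoReply ι         p = p
O-effect-NoReply (send m₁) p = p
O-effect-NoReply (send m₂) p = p
O-effect-NoReply (send m₃) p = p
O-effect-NoReply (send m₄) p = p

Unreached : Valuation → Set
Unreached (o , r) = NoReply o × EOO r ≡ false

≡false⇒≢true : ∀ {b} → b ≡ false → b ≢ true
≡false⇒≢true refl ()

Unreached⇒φ-R : ∀ t → (∀ n → Unreached (t n)) → t ∈ φ-R
-- The formula reads position 0 of the suffix from `n`, which is `t (n + 0)`.
Unreached⇒φ-R t inv n eoo = contradiction eoo (≡false⇒≢true (proj₂ (inv (n + 0))))

Unreached⇒¬φ-O : ∀ t → (∀ n → Unreached (t n)) → t ∉ φ-O
Unreached⇒¬φ-O t inv (_ , always) with always 0
... | inj₁ (inj₁ (n , sig))       = ≡false⇒≢true (proj₁ (proj₁ (inv (n + 0)))) sig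
... | inj₁ (inj₂ ((n , sig) , _)) = ≡false⇒≢true (proj₁ (proj₂ (proj₁ (inv (n + 0))))) sig
... | inj₂ ((n , ab) , _)         = ≡false⇒≢true (proj₂ (proj₂ (proj₁ (inv (n + 0))))) ab

module IdleRecipient (O′ : Process OVal) where

  advance : Agent → Valuation → Valuation
  advance originator (o , r) = effect O′ o (proj₁ (nonempty O′ o)) , r
  advance recipient  v       = v

  advance-turn : ∀ a v → Turn O′ R a v (advance a v)
  advance-turn originator (o , r) = O-turn (proj₂ (nonempty O′ o))
  advance-turn recipient  (o , r) = R-turn idle

  trace : Trace
  trace zero    = initial
  trace (suc n) = advance (alternate (suc n)) (trace n)

  trace-generated : Generates O′ R roundRobin trace
  trace-generated .start  = refl
  trace-generated .step n =
    -- `trace` picks the agent by index, while `step` asks the scheduler about the history; the two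
    -- answers are equal. The empty delivery list below is the channel losing everything.
    subst (λ a → Step O′ R a (trace n) (trace (suc n))) (sym (scheduled-roundRobin trace n))
      (trace (suc n) , _ , advance-turn _ (trace n) , [] , refl)

  trace-∈ : trace ∈ ⟦ O′ ∥ R ∥Sc⟧
  trace-∈ = roundRobin , roundRobin-fair O′ R , trace-generated

  module _ (O′≼O : O′ ≼ O) where

    advance-Unreached : ∀ a {v} → Unreached v → Unreached (advance a v)
    advance-Unreached originator {o , r} (p , q) with nonempty O′ o
    -- The chosen move is one of `O′`, and refinement gives it the same effect as in `O`; `EOO` lies
    -- on the recipient's side and is untouched.
    ... | m , m∈ = subst NoReply (sym (effect-same O′≼O o m∈)) (O-effect-NoReply m p) , q
    advance-Unreached recipient  pq = pq

    trace-Unreached : ∀ n → Unreached (trace n)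
    trace-Unreached zero    = (refl , refl , refl) , refl
    trace-Unreached (suc n) = advance-Unreached (alternate (suc n)) (trace-Unreached n)

theorem4 : (O′ : Process OVal) (R′ : Process RVal) → O′ ≼ O → R′ ≼ R →
    (⟦ O′ ∥ R ∥Sc⟧ ⊈ φ-O)
    × ((⟦ O′ ∥ R ∥Sc⟧ ⊈ (φ-R ⇒ φ-O))
    ⊎ ((⟦ O′ ∥ R ∥Sc⟧ ⊆ (φ-R ⇒ φ-O))
    × (⟦ O ∥ R′ ∥Sc⟧ ⊆ (φ-O ⇒ φ-R))
    × (⟦ O′ ∥ R′ ∥Sc⟧ ⊈ (φ-O ∩ φ-R))))
theorem4 O′ R′ O′≼O R′≼R =
    (λ sub → trace∉φ-O (sub trace-∈))
  , inj₁ (λ sub → trace∉φ-O (sub trace-∈ (Unreached⇒φ-R trace unreached)))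
  where
  open IdleRecipient O′

  unreached : ∀ n → Unreached (trace n)
  unreached = trace-Unreached O′≼O

  trace∉φ-O : trace ∉ φ-O
  trace∉φ-O = Unreached⇒¬φ-O trace unreached
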